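{- If Markov's principle holds and either $\mathbb{N}^{\mathbb{N}}$ or $2^{\mathbb{N}}$ has the $\neg\neg$ strong Myhill property, then the limited principle of omniscience $\mathsf{LPO}$ holds.
   Context: The statement is to be proved constructively (intuitionistic set theory with powersets and $\mathbb{N}$, equivalently the internal logic of a topos with natural numbers object; neither excluded middle nor choice is assumed). Markov's principle: for every $p \in 2^{\mathbb{N}}$, if $p \neq 0^\omega$ (the constant $0$ sequence), then there exists $n$ with $p_n = 1$. $\mathsf{LPO}$: for every $p \in 2^{\mathbb{N}}$, either $p = 0^\omega$ or there exists $n$ with $p_n = 1$. For injections $f, g : X \to X$ and $m \in \mathbb{Z}$, let $R^{f,g}_m \subseteq X \times X$ be the partial injection $f \circ (g \circ f)^m$: for $m \ge 0$, $(x,y) \in R^{f,g}_m$ iff $y = f((g\circ f)^m(x))$; for $m < 0$, $(x,y) \in R^{f,g}_m$ iff $x = g((f \circ g)^{ -m-1}(y))$. A set $X$ has the $\neg\neg$ strong Myhill property if for every pair of injections $f, g : X \to X$ there is a bijection $h : X \to X$ such that for every $x \in X$, $\neg\neg\, \exists m \in \mathbb{Z}.\ (x,h(x)) \in R^{f,g}_m$. -}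

module Defs where

open import Data.Bool.Base using (Bool; true; false)
open import Data.Integer.Base using (ℤ; +_; -[1+_])
open import Data.Nat.Base using (ℕ)
open import Data.Nat.GeneralisedArithmetic using (fold)
open import Data.Product.Base using (∃; ∃-syntax)
open import Data.Sum.Base using (_⊎_)
open import Function.Base using (_∘_; const)
open import Function.Bundles using (Injection; Bijection)
open import Level using (Level; _⊔_)
open import Relation.Binary.Bundles using (Setoid)
open import Relation.Binary.PropositionalEquality using (_≡_; _≗_; _→-setoid_)
open import Relation.Nullary.Negation.Core using (¬_)

-- Sets of sequences are setoids under pointwise equality, since
-- function extensionality is not available for _≡_.

Baire : Setoid _ _
Baire = ℕ →-setoid ℕ

Cantor : Setoid _ _
Cantor = ℕ →-setoid Bool

0^ω : ℕ → Bool
0^ω = const false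

MarkovsPrinciple : Set
MarkovsPrinciple = (p : ℕ → Bool) → ¬ (p ≗ 0^ω) → ∃[ n ] p n ≡ true

LPO : Set
LPO = (p : ℕ → Bool) → p ≗ 0^ω ⊎ (∃[ n ] p n ≡ true)

module _ {c ℓ : Level} (X : Setoid c ℓ) where

  open Setoid X using (Carrier; _≈_)

  -- R f g m is the graph of the partial injection f ∘ (g ∘ f)ᵐ.
  -- As -[1+ n ] denotes -(n + 1), the exponent -m - 1 is n when m is negative.
  R : Injection X X → Injection X X → ℤ → Carrier → Carrier → Set ℓ
  R f g m x y = graph m
    where
    open Injection f using () renaming (to to f⟨_⟩)
    open Injection g using () renaming (to to g⟨_⟩)

    graph : ℤ → Set ℓ
    graph (+ n)    = y ≈ f⟨ fold x (g⟨_⟩ ∘ f⟨_⟩) n ⟩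
    graph -[1+ n ] = x ≈ g⟨ fold y (f⟨_⟩ ∘ g⟨_⟩) n ⟩

  ¬¬StrongMyhill : Set (c ⊔ ℓ)
  ¬¬StrongMyhill =
    (f g : Injection X X) →
    ∃ λ (h : Bijection X X) →
      ∀ x → ¬ ¬ (∃[ m ] R f g m x (Bijection.to h x))

-- Apply the property to f = g = φ, where φ(0ᵏ⁺¹ay) = 0ᵏa0y and φ(ay) = a1y for a ≠ 0, and
-- φ(0^ω) = 0^ω. Then h moves every point by an odd number of steps along its φ-orbit. The orbit
-- of 0ⁿ11000… runs through the points 0ᵏ10ⁿ⁻ᵏ1000… and enters the set of sequences with nonzero
-- head after n steps. If h and its inverse are continuous at 0^ω and at the points 0ᵏ1000…, then
-- for large n the set of k for which h (or its inverse) leads from 0ᵏ10ⁿ⁻ᵏ1000… to a nonzero head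
-- does not depend on n and is bounded. As h matches the remaining k of one parity with the
-- remaining k of the other, passing from n to n + 1 adds an element on one side only, which is
-- impossible. Markov's principle yields LPO or the required continuity: the values of a function
-- at glued sequences decide whether it is discontinuous, and discontinuity implies LPO.

module Submission where

open import Defs
open import Data.Bool.Base using (Bool; true; false; _∧_; _xor_; if_then_else_)
open import Data.Bool.Properties using (¬-not; xor-same; ∧-conicalˡ; ∧-conicalʳ)
  renaming (_≟_ to _≟ᵇ_)
open import Data.Empty using (⊥; ⊥-elim)
open import Data.Fin.Base using (Fin; toℕ; fromℕ<)
import Data.Fin.Properties as Fin
open import Data.Integer.Base using (+_; -[1+_])
open import Data.Nat.Base
open import Data.Nat.GeneralisedArithmetic using (fold)
open import Data.Nat.Properties
open import Data.Parity.Base using (_⁻¹)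
open import Data.Parity.Properties using (suc-homo-⁻¹; p≢p⁻¹) renaming (_≟_ to _≟ᵖ_)
open import Data.Product.Base using (∃; ∃-syntax; _×_; _,_; proj₁; proj₂)
open import Data.Sum.Base using (_⊎_; inj₁; inj₂; [_,_]′)
open import Effect.Monad using (RawMonad)
open import Function.Base using (_∘_; id; const)
open import Function.Bundles using (Injection; Bijection)
open import Relation.Binary.Bundles using (Setoid)
open import Relation.Binary.PropositionalEquality
open import Relation.Nullary.Decidable.Core using (Dec; yes; no; _×-dec_)
open import Relation.Nullary.Negation using (¬_; contradiction; ¬¬-Monad)

private
  variable
    A : Set

true≢false : {b : Bool} → b ≡ true → b ≢ false
true≢false refl ()

¬-false : {b : Bool} → b ≢ true → b ≡ false
¬-false = ¬-not

xor-false : ∀ {a b} → a xor b ≡ false → a ≡ b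
xor-false {true}  {true}  _ = refl
xor-false {false} {false} _ = refl

-- Gluing sequences to decide instances of LPO.

Extensional : ((ℕ → Bool) → A) → Set
Extensional F = ∀ {x y} → x ≗ y → F x ≡ F y

Null : (ℕ → ℕ → Bool) → Set
Null z = ∀ i n → n < i → z i n ≡ false

-- The sequence z i for the least i with p i ≡ true, and 0^ω when there is none.
-- Since z i has i leading zeros, this is computable without deciding which case holds.
glue : (ℕ → Bool) → (ℕ → ℕ → Bool) → ℕ → Bool
glue p z zero    = if p 0 then z 0 0 else false
glue p z (suc n) = if p 0 then z 0 (suc n) else glue (p ∘ suc) (λ i → z (suc i) ∘ suc) n

glue-none : ∀ {p} z → p ≗ 0^ω → glue p z ≗ 0^ω
glue-none z p≗0 zero    rewrite p≗0 0 = refl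
glue-none z p≗0 (suc n) rewrite p≗0 0 = glue-none _ (p≗0 ∘ suc) n

glue-zero : ∀ {p} z → p 0 ≡ true → glue p z ≗ z 0
glue-zero z p0 zero    rewrite p0 = refl
glue-zero z p0 (suc n) rewrite p0 = refl

glue-suc : ∀ {p} z i → p 0 ≡ false → z (suc i) 0 ≡ false →
           glue (p ∘ suc) (λ j → z (suc j) ∘ suc) ≗ z (suc i) ∘ suc → glue p z ≗ z (suc i)
glue-suc z i p0 zi0 eq zero    rewrite p0 = sym zi0
glue-suc z i p0 zi0 eq (suc n) rewrite p0 = eq n

-- The `j` found is the least index with `p j ≡ true`, possibly below `i`; by `Null`, the zeros
-- emitted before reaching it are those of `z j`.
glue-some : ∀ p z → Null z → ∀ i → p i ≡ true → ∃[ j ] (p j ≡ true × glue p z ≗ z j)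
glue-some p z null i pi with p 0 in p0
glue-some p z null i       pi | true  = 0 , p0 , glue-zero z p0
glue-some p z null zero    pi | false = contradiction p0 (true≢false pi)
glue-some p z null (suc i) pi | false
  with j , pj , eq ← glue-some (p ∘ suc) _ (λ i n n<i → null (suc i) (suc n) (s≤s n<i)) i pi
  = suc j , pj , glue-suc z j p0 (null (suc j) 0 z<s) eq

module _ (F : (ℕ → Bool) → Bool) (F-ext : Extensional F) where

  glue-search : ∀ p z → Null z → (∀ i → p i ≡ true → F (z i) ≡ true) →
                F (glue p z) ≡ false → p ≗ 0^ω
  glue-search p z null pF Fglue i = ¬-false λ pi →
    let j , pj , eq = glue-some p z null i pi in
    true≢false (trans (F-ext eq) (pF j pj)) Fglue

  module _ (mp : MarkovsPrinciple) (F0 : F 0^ω ≡ false) where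

    glue-search⁺ : ∀ p z → F (glue p z) ≡ true → ∃[ i ] p i ≡ true
    glue-search⁺ p z Fglue = mp p λ p≗0 →
      true≢false Fglue (trans (F-ext (glue-none z p≗0)) F0)

    -- One value of `F` tells the cases apart: by `F0` it is false at `0^ω`, by `pF` true at every
    -- `z j` that gluing can yield. Markov's principle supplies the index.
    glue-decide : ∀ p z → Null z → (∀ i → p i ≡ true → F (z i) ≡ true) →
                  p ≗ 0^ω ⊎ (∃[ i ] p i ≡ true)
    glue-decide p z null pF with F (glue p z) in eq
    ... | true  = inj₂ (glue-search⁺ p z eq)
    ... | false = inj₁ (glue-search p z null pF eq)

    module _ (z : ℕ → ℕ → Bool) (null : Null z) where

      tail-decide : ∀ N → (λ k → F (z (N + k))) ≗ 0^ω ⊎ (∃[ k ] F (z (N + k)) ≡ true)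
      tail-decide N = glue-decide _ (λ i → z (N + i))
        (λ i n n<i → null (N + i) n (<-≤-trans n<i (m≤n+m i N))) (λ _ → id)

      vanishesFrom : ℕ → Bool
      vanishesFrom N = [ const true , const false ]′ (tail-decide N)

      vanishesFrom-sound : ∀ N → vanishesFrom N ≡ true → ∀ k → N ≤ k → F (z k) ≡ false
      vanishesFrom-sound N eq k N≤k with tail-decide N
      ... | inj₁ all = subst (λ m → F (z m) ≡ false) (m+[n∸m]≡n N≤k) (all (k ∸ N))

      vanishesFrom-complete : ∀ N → (∀ k → N ≤ k → F (z k) ≡ false) → vanishesFrom N ≡ true
      vanishesFrom-complete N h with tail-decide N
      ... | inj₁ _        = refl
      ... | inj₂ (k , eq) = contradiction (h (N + k) (m≤m+n N k)) (true≢false eq)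

      -- Moving each index `i` on to a place where `F` is true keeps the `i` leading zeros, so every
      -- `p` can be tested.
      cofinal⇒LPO : (∀ N → ∃[ k ] F (z (N + k)) ≡ true) → LPO
      cofinal⇒LPO κ p = glue-decide p (λ i → z (i + proj₁ (κ i)))
        (λ i n n<i → null _ n (<-≤-trans n<i (m≤m+n i _))) (λ i _ → proj₂ (κ i))

      nonvanishing⇒LPO : (∀ N → vanishesFrom N ≡ false) → LPO
      nonvanishing⇒LPO nv = cofinal⇒LPO λ N → go N (nv N)
        where
        go : ∀ N → vanishesFrom N ≡ false → ∃[ k ] F (z (N + k)) ≡ true
        go N eq with tail-decide N
        ... | inj₂ r = r

      -- Let i be the last index with F (z i) ≡ true, if any. The test of F on the glued
      -- sequence decides whether there is such a last index.
      eventually-false : LPO ⊎ (∃[ N ] ∀ k → N ≤ k → F (z k) ≡ false)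
      eventually-false with glue-decide (λ i → vanishesFrom (suc i) ∧ F (z i)) z null
                              (λ i → ∧-conicalʳ (vanishesFrom (suc i)) _)
      ... | inj₂ (i , eq) = inj₂ (suc i , vanishesFrom-sound (suc i) (∧-conicalˡ _ _ eq))
      ... | inj₁ noLast with vanishesFrom 0 in v0
      ...   | true  = inj₂ (0 , vanishesFrom-sound 0 v0)
      ...   | false = inj₁ (nonvanishing⇒LPO never)
        where
        never : ∀ N → vanishesFrom N ≡ false
        never zero    = v0
        -- If `F` vanishes from `suc N` on, it also vanishes at `N`, as `N` is not a last index;
        -- this contradicts `never N`.
        never (suc N) = ¬-false λ v →
          let FzN : F (z N) ≡ false
              FzN = trans (cong (_∧ F (z N)) (sym v)) (noLast N)
              vN = vanishesFrom-complete N λ k N≤k →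
                [ vanishesFrom-sound (suc N) v k , (λ { refl → FzN }) ]′ (m≤n⇒m<n∨m≡n N≤k)
          in true≢false vN (never N)

-- Continuity at the limits of the points 0ᵏ10ʲ1000....

-- at k x is the sequence 0ᵏ1x.
at : ℕ → (ℕ → Bool) → ℕ → Bool
at zero    x zero    = true
at zero    x (suc n) = x n
at (suc k) x zero    = false
at (suc k) x (suc n) = at k x n

at-cong : ∀ k {x y} → x ≗ y → at k x ≗ at k y
at-cong zero    x≗y zero    = refl
at-cong zero    x≗y (suc n) = x≗y n
at-cong (suc k) x≗y zero    = refl
at-cong (suc k) x≗y (suc n) = at-cong k x≗y n

at-null : (y : ℕ → ℕ → Bool) → Null (λ k → at k (y k))
at-null y i n = go i n
  where
  go : ∀ i {x} n → n < i → at i x n ≡ false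
  go (suc i) zero    _         = refl
  go (suc i) (suc n) (s≤s n<i) = go i n n<i

pt : ℕ → ℕ → ℕ → Bool
pt k j = at k (at j 0^ω)

module _ (mp : MarkovsPrinciple) (F : (ℕ → Bool) → Bool) (F-ext : Extensional F)
         (F0 : F 0^ω ≡ false) where

  -- For each k, the second half of the sequence is chosen to be a point where F (at k -) is
  -- true if there is one among the at j 0^ω; this turns uniformity in j into convergence
  -- along a single sequence.
  uniformly-false : LPO ⊎ (∃[ N ] ∀ k → N ≤ k → ∀ j → F (pt k j) ≡ false)
  uniformly-false with eventually-false F F-ext mp F0 _ (at-null worst)
    where
    worst : ℕ → ℕ → Bool
    worst k = glue (λ j → F (pt k j)) (λ j → at j 0^ω)
  ... | inj₁ lpo     = inj₁ lpo
  ... | inj₂ (N , h) = inj₂ (N , λ k N≤k →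
    glue-search (F ∘ at k) (F-ext ∘ at-cong k) _ _ (at-null _) (λ _ → id) (h k N≤k))

  -- Taking `xor` with the limit value reduces constancy to vanishing.
  row-constant : ∀ k → LPO ⊎ (∃[ N ] ∀ j → N ≤ j → F (pt k j) ≡ F (at k 0^ω))
  row-constant k
    with eventually-false (λ x → F (at k x) xor F (at k 0^ω))
           (λ x≗y → cong (_xor F (at k 0^ω)) (F-ext (at-cong k x≗y)))
           mp (xor-same (F (at k 0^ω))) _ (at-null (const 0^ω))
  ... | inj₁ lpo     = inj₁ lpo
  ... | inj₂ (N , h) = inj₂ (N , λ j N≤j → xor-false (h j N≤j))

  rows-constant : ∀ K → LPO ⊎ (∃[ N ] ∀ k → k < K → ∀ j → N ≤ j → F (pt k j) ≡ F (at k 0^ω))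
  rows-constant zero = inj₂ (0 , λ _ ())
  rows-constant (suc K) with rows-constant K | row-constant K
  ... | inj₁ lpo     | _            = inj₁ lpo
  ... | inj₂ _       | inj₁ lpo     = inj₁ lpo
  ... | inj₂ (N , h) | inj₂ (M , g) = inj₂ (N ⊔ M , λ k k<1+K j N⊔M≤j →
    [ (λ k<K → h k k<K j (m⊔n≤o⇒m≤o N M N⊔M≤j))
    , (λ { refl → g j (m⊔n≤o⇒n≤o N M N⊔M≤j) })
    ]′ (m≤n⇒m<n∨m≡n (s≤s⁻¹ k<1+K)))

-- While the head is zero, `φ` preserves `k + j` on the points `pt k j`, so the second clause
-- compares consecutive orbits at the same `k`.
Stable : (ℕ → ℕ → Bool) → ℕ → Set
Stable a N = (∀ k j → N ≤ k → a k j ≡ false) × (∀ k j → N ≤ k + j → a k (suc j) ≡ a k j)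

Stable-mono : ∀ {a M N} → M ≤ N → Stable a M → Stable a N
Stable-mono M≤N (v , c) = (λ k j N≤k → v k j (≤-trans M≤N N≤k))
                        , (λ k j N≤k+j → c k j (≤-trans M≤N N≤k+j))

eventually-stable : MarkovsPrinciple → (F : (ℕ → Bool) → Bool) → Extensional F →
                    F 0^ω ≡ false → LPO ⊎ ∃ (Stable (λ k j → F (pt k j)))
eventually-stable mp F F-ext F0 with uniformly-false mp F F-ext F0
... | inj₁ lpo = inj₁ lpo
... | inj₂ (K , v) with rows-constant mp F F-ext F0 K
...   | inj₁ lpo     = inj₁ lpo
-- The sum `K + L` serves as bound because with `k < K` it forces `L ≤ j`.
...   | inj₂ (L , c) = inj₂ (K + L , (λ k j K+L≤k → v k (≤-trans (m≤m+n K L) K+L≤k) j) , stable)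
  where
  stable : ∀ k j → K + L ≤ k + j → F (pt k (suc j)) ≡ F (pt k j)
  stable k j K+L≤k+j with k <? K
  ... | no  k≮K = trans (v k (≮⇒≥ k≮K) (suc j)) (sym (v k (≮⇒≥ k≮K) j))
  ... | yes k<K = trans (c k k<K (suc j) (m≤n⇒m≤1+n L≤j)) (sym (c k k<K j L≤j))
    where
    L≤j : L ≤ j
    L≤j = +-cancelˡ-≤ K L j (≤-trans K+L≤k+j (+-monoˡ-≤ j (<⇒≤ k<K)))

-- A double-negated pigeonhole principle.

¬¬-finite : ∀ {n} {P : Fin n → Set} → (∀ i → ¬ ¬ P i) → ¬ ¬ (∀ i → P i)
¬¬-finite = Fin.sequence (RawMonad.rawApplicative ¬¬-Monad)

-- As the goal is `⊥`, the finitely many witnesses can be freed of their double negations all at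
-- once, which makes `Θ` a function on `Fin (suc N)`.
¬¬-pigeonhole : ∀ N (Θ : ℕ → ℕ → Set) →
                (∀ k → k < suc N → ¬ ¬ (∃[ m ] (m < N × Θ k m))) →
                (∀ {k l m} → Θ k m → Θ l m → k ≡ l) → ⊥
¬¬-pigeonhole N Θ total inj =
  ¬¬-finite (λ i → total (toℕ i) (Fin.toℕ<n i)) λ θ →
    Fin.<⇒notInjective {f = λ i → fromℕ< (proj₁ (proj₂ (θ i)))} ≤-refl λ {i} {j} eq →
      Fin.toℕ-injective (inj (proj₂ (proj₂ (θ i)))
        (subst (Θ (toℕ j)) (sym (Fin.fromℕ<-injective _ _ _ _ eq)) (proj₂ (proj₂ (θ j)))))

-- The injection `φ` on sequences of digits.

-- Both ℕ and Bool serve as the set of digits; nonzero separates the images of the two bits.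
module Sequences (D : Set) (⌜_⌝ : Bool → D) (nonzero : D → Bool)
                 (nonzero-⌜⌝ : ∀ b → nonzero ⌜ b ⌝ ≡ b)
                 (is-zero : ∀ d → nonzero d ≡ false → d ≡ ⌜ false ⌝) where

  X : Setoid _ _
  X = ℕ →-setoid D

  private
    variable
      x y z : ℕ → D

  infixr 5 _∷_

  _∷_ : D → (ℕ → D) → ℕ → D
  (d ∷ x) zero    = d
  (d ∷ x) (suc n) = x n

  -- ins sends 0ᵏay to 0ᵏa0y, for a ≠ 0.
  ins : (ℕ → D) → ℕ → D
  ins x zero    = x 0
  ins x (suc n) = if nonzero (x 0) then (⌜ false ⌝ ∷ x ∘ suc) n else ins (x ∘ suc) n

  -- For a ≠ 0, φ sends 0ᵏ⁺¹ay to 0ᵏa0y and ay to a1y.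
  φ : (ℕ → D) → ℕ → D
  φ x = if nonzero (x 0) then x 0 ∷ ⌜ true ⌝ ∷ x ∘ suc else ins (x ∘ suc)

  ∷-cong : ∀ d → x ≗ y → d ∷ x ≗ d ∷ y
  ∷-cong d x≗y zero    = refl
  ∷-cong d x≗y (suc n) = x≗y n

  ins-cong : x ≗ y → ins x ≗ ins y
  ins-cong x≗y zero = x≗y 0
  ins-cong {x} x≗y (suc n) rewrite sym (x≗y 0) with nonzero (x 0)
  ... | true  = ∷-cong _ (x≗y ∘ suc) n
  ... | false = ins-cong (x≗y ∘ suc) n

  φ-cong : x ≗ y → φ x ≗ φ y
  φ-cong {x} x≗y n rewrite sym (x≗y 0) with nonzero (x 0)
  ... | true  = ∷-cong _ (∷-cong _ (x≗y ∘ suc)) n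
  ... | false = ins-cong (x≗y ∘ suc) n

  ins-injective : ins x ≗ ins y → x ≗ y
  ins-injective eq zero = eq 0
  ins-injective {x} {y} eq (suc n) with eq 0 | eq ∘ suc
  ... | x0≡y0 | eq′ rewrite sym x0≡y0 with nonzero (x 0)
  ...   | true  = eq′ (suc n)
  ...   | false = ins-injective eq′ n

  ins-nonzero : ∀ x → nonzero (x 0) ≡ true → ins x 1 ≡ ⌜ false ⌝
  ins-nonzero x x0 rewrite x0 = refl

  ⌜⌝-injective : ∀ {a b} → ⌜ a ⌝ ≡ ⌜ b ⌝ → a ≡ b
  ⌜⌝-injective {a} {b} eq = trans (sym (nonzero-⌜⌝ a)) (trans (cong nonzero eq) (nonzero-⌜⌝ b))

  -- After a leading nonzero digit, images under ins continue with 0 and those under φ with 1.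
  ins≢1∷ : ∀ x {d y} → nonzero d ≡ true → ¬ (ins x ≗ d ∷ ⌜ true ⌝ ∷ y)
  ins≢1∷ x d≠0 eq with () ← ⌜⌝-injective
    (trans (sym (ins-nonzero x (trans (cong nonzero (eq 0)) d≠0))) (eq 1))

  φ-injective : φ x ≗ φ y → x ≗ y
  φ-injective {x} {y} eq with nonzero (x 0) in x0 | nonzero (y 0) in y0
  ... | true  | true  = λ { zero → eq 0 ; (suc n) → eq (suc (suc n)) }
  ... | true  | false = contradiction (sym ∘ eq) (ins≢1∷ (y ∘ suc) x0)
  ... | false | true  = contradiction eq (ins≢1∷ (x ∘ suc) y0)
  ... | false | false = λ
    { zero    → trans (is-zero _ x0) (sym (is-zero _ y0))
    ; (suc n) → ins-injective eq n
    }

  φ-injection : Injection X X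
  φ-injection = record { to = φ ; cong = φ-cong ; injective = φ-injective }

  φ-nonzero : ∀ x → nonzero (x 0) ≡ true → φ x ≗ x 0 ∷ ⌜ true ⌝ ∷ x ∘ suc
  φ-nonzero x x0 n rewrite x0 = refl

  φ-zero : ∀ x → nonzero (x 0) ≡ false → φ x ≗ ins (x ∘ suc)
  φ-zero x x0 n rewrite x0 = refl

  φ-head : ∀ x → nonzero (φ x 0) ≡ false → nonzero (x 0) ≡ false
  φ-head x eq = ¬-false λ x0 →
    true≢false (trans (cong nonzero (φ-nonzero x x0 0)) x0) eq

  ⟪_⟫ : (ℕ → Bool) → ℕ → D
  ⟪ x ⟫ n = ⌜ x n ⌝

  ⟪⟫-cong : ∀ {x y} → x ≗ y → ⟪ x ⟫ ≗ ⟪ y ⟫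
  ⟪⟫-cong x≗y n = cong ⌜_⌝ (x≗y n)

  ins-at : ∀ k {x x′} → (∀ n → (⌜ false ⌝ ∷ ⟪ x ⟫) n ≡ ⟪ x′ ⟫ n) → ins ⟪ at k x ⟫ ≗ ⟪ at k x′ ⟫
  ins-at zero    eq zero    = refl
  ins-at zero    eq (suc n) rewrite nonzero-⌜⌝ true = eq n
  ins-at (suc k) eq zero    = refl
  ins-at (suc k) eq (suc n) rewrite nonzero-⌜⌝ false = ins-at k eq n

  φ-pt : ∀ k j → φ ⟪ pt (suc k) j ⟫ ≗ ⟪ pt k (suc j) ⟫
  φ-pt k j n = trans (φ-zero ⟪ pt (suc k) j ⟫ (nonzero-⌜⌝ false) n)
    (ins-at k (λ { zero → refl ; (suc n) → refl }) n)

  ins-0^ω : ins ⟪ 0^ω ⟫ ≗ ⟪ 0^ω ⟫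
  ins-0^ω zero = refl
  ins-0^ω (suc n) rewrite nonzero-⌜⌝ false = ins-0^ω n

  φ-0^ω : φ ⟪ 0^ω ⟫ ≗ ⟪ 0^ω ⟫
  φ-0^ω n = trans (φ-zero ⟪ 0^ω ⟫ (nonzero-⌜⌝ false) n) (ins-0^ω n)

  -- In `pt k 0` the first nonzero digit is followed by `1`, where `ins` always writes `0`.
  ins-misses : ∀ k x → ¬ (ins x ≗ ⟪ pt k 0 ⟫)
  ins-misses zero x eq = ins≢1∷ x (nonzero-⌜⌝ true)
    (λ { zero → eq 0 ; (suc zero) → eq 1 ; (suc (suc n)) → eq (suc (suc n)) })
  ins-misses (suc k) x eq = ins-misses k (x ∘ suc) λ n →
    trans (sym (ins-suc n)) (eq (suc n))
    where
    ins-suc : ∀ n → ins x (suc n) ≡ ins (x ∘ suc) n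
    ins-suc n rewrite eq 0 | nonzero-⌜⌝ false = refl

  φ-misses : ∀ k x → ¬ (φ x ≗ ⟪ pt (suc k) 0 ⟫)
  φ-misses k x eq = ins-misses (suc k) (x ∘ suc) λ n → trans (sym (φ-zero x x0 n)) (eq n)
    where
    x0 : nonzero (x 0) ≡ false
    x0 = φ-head x (trans (cong nonzero (eq 0)) (nonzero-⌜⌝ false))

  φ-pt⁻¹ : ∀ k j z → φ z ≗ ⟪ pt (suc k) j ⟫ →
           ∃[ i ] (suc i ≡ j × z ≗ ⟪ pt (suc (suc k)) i ⟫)
  φ-pt⁻¹ k zero    z eq = contradiction eq (φ-misses k z)
  φ-pt⁻¹ k (suc j) z eq = j , refl ,
    φ-injective (λ n → trans (eq n) (sym (φ-pt (suc k) j n)))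

  pt-injective : ∀ {k l} i j → ⟪ pt k i ⟫ ≗ ⟪ pt l j ⟫ → k ≡ l
  pt-injective {zero}  {zero}  i j eq = refl
  pt-injective {zero}  {suc l} i j eq with () ← ⌜⌝-injective (eq 0)
  pt-injective {suc k} {zero}  i j eq with () ← ⌜⌝-injective (eq 0)
  pt-injective {suc k} {suc l} i j eq = cong suc (pt-injective i j (eq ∘ suc))

  -- Odd numbers of steps along the orbits of `φ`.

  φ^ : ℕ → (ℕ → D) → ℕ → D
  φ^ m x = φ (fold x (φ ∘ φ) m)

  φ^-cong : ∀ m → x ≗ y → φ^ m x ≗ φ^ m y
  φ^-cong zero    x≗y = φ-cong x≗y
  φ^-cong (suc m) x≗y = φ-cong (φ-cong (φ^-cong m x≗y))

  φ^-0^ω : ∀ m → φ^ m ⟪ 0^ω ⟫ ≗ ⟪ 0^ω ⟫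
  φ^-0^ω zero    n = φ-0^ω n
  φ^-0^ω (suc m) n = trans (φ-cong (φ-cong (φ^-0^ω m)) n) (trans (φ-cong φ-0^ω n) (φ-0^ω n))

  φ^-injective : ∀ m → φ^ m x ≗ φ^ m y → x ≗ y
  φ^-injective zero    eq = φ-injective eq
  φ^-injective (suc m) eq = φ^-injective m (φ-injective (φ-injective eq))

  Linked : (ℕ → D) → (ℕ → D) → Set
  Linked x y = ∃[ m ] (y ≗ φ^ m x ⊎ x ≗ φ^ m y)

  R⇒Linked : ∀ m → R X φ-injection φ-injection m x y → Linked x y
  R⇒Linked (+ m)    eq = m , inj₁ eq
  R⇒Linked -[1+ m ] eq = m , inj₂ eq

  Linked-sym : Linked x y → Linked y x
  Linked-sym (m , inj₁ eq) = m , inj₂ eq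
  Linked-sym (m , inj₂ eq) = m , inj₁ eq

  Linked-congʳ : y ≗ z → Linked x y → Linked x z
  Linked-congʳ y≗z (m , inj₁ eq) = m , inj₁ λ n → trans (sym (y≗z n)) (eq n)
  Linked-congʳ y≗z (m , inj₂ eq) = m , inj₂ λ n → trans (eq n) (φ^-cong m y≗z n)

  -- The zero sequence is a fixed point of the injective `φ`, so it is alone in its orbit.
  Linked-0^ω : Linked ⟪ 0^ω ⟫ y → y ≗ ⟪ 0^ω ⟫
  Linked-0^ω (m , inj₁ eq) n = trans (eq n) (φ^-0^ω m n)
  Linked-0^ω (m , inj₂ eq) = φ^-injective m λ n → trans (sym (eq n)) (sym (φ^-0^ω m n))

  -- The parity changes because a link consists of 2m + 1 steps of `φ`, forward or backward, each
  -- moving one zero between the two blocks.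
  record Partner (k j : ℕ) (y : ℕ → D) : Set where
    constructor partner
    field
      {k′ j′} : ℕ
      total   : k′ + j′ ≡ k + j
      parity′ : parity k′ ≡ parity (suc k)
      at-pt   : y ≗ ⟪ pt (suc k′) j′ ⟫

  φ-pt⁺ : ∀ k j → nonzero (φ ⟪ pt (suc k) j ⟫ 0) ≡ false →
          ∃[ l ] (suc l ≡ k × φ ⟪ pt (suc k) j ⟫ ≗ ⟪ pt (suc l) (suc j) ⟫)
  φ-pt⁺ zero    j eq = contradiction eq
    (true≢false (trans (cong nonzero (φ-pt 0 j 0)) (nonzero-⌜⌝ true)))
  φ-pt⁺ (suc k) j eq = k , refl , φ-pt (suc k) j

  -- A nonzero head stays nonzero under `φ`, so a zero head at the end forces one at every
  -- intermediate point and `φ-pt⁺` applies throughout.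
  forward : ∀ m k j → nonzero (φ^ m ⟪ pt (suc k) j ⟫ 0) ≡ false →
            Partner k j (φ^ m ⟪ pt (suc k) j ⟫)
  forward zero k j eq with φ-pt⁺ k j eq
  ... | l , refl , e = partner (+-suc l j) refl e
  forward (suc m) k j eq with φ-head (φ (φ^ m ⟪ pt (suc k) j ⟫)) eq
  ... | eq₁ with forward m k j (φ-head (φ^ m ⟪ pt (suc k) j ⟫) eq₁)
  ... | partner {k′} {j′} t p e
    with φ-pt⁺ k′ j′ (trans (cong nonzero (sym (φ-cong e 0))) eq₁)
  ... | l , refl , e₁
    with φ-pt⁺ l (suc j′) (trans (cong nonzero (sym (φ-cong (λ n → trans (φ-cong e n) (e₁ n)) 0))) eq)
  ... | i , refl , e₂ = partner
    (trans (+-suc i (suc j′)) (trans (cong suc (+-suc i j′)) t)) p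
    (λ n → trans (φ-cong (λ n → trans (φ-cong e n) (e₁ n)) n) (e₂ n))

  backward : ∀ m k j y → φ^ m y ≗ ⟪ pt (suc k) j ⟫ → Partner k j y
  backward zero k j y eq with φ-pt⁻¹ k j y eq
  ... | i , refl , e = partner (sym (+-suc k i)) refl e
  backward (suc m) k j y eq with φ-pt⁻¹ k j (φ (φ^ m y)) eq
  ... | i , refl , e with φ-pt⁻¹ (suc k) i (φ^ m y) e
  ... | i′ , refl , e′ with backward m (suc (suc k)) i′ y e′
  ... | partner t p e″ = partner
    (trans t (sym (trans (+-suc k (suc i′)) (cong suc (+-suc k i′))))) p e″

  Linked-pt : ∀ k j → Linked ⟪ pt (suc k) j ⟫ y → nonzero (y 0) ≡ false → Partner k j y
  Linked-pt k j (m , inj₂ eq) y0 = backward m k j _ (sym ∘ eq)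
  Linked-pt k j (m , inj₁ eq) y0 with forward m k j (trans (cong nonzero (sym (eq 0))) y0)
  ... | partner t p e = partner t p (λ n → trans (eq n) (e n))

  heads : ((ℕ → D) → ℕ → D) → ℕ → ℕ → Bool
  heads H k j = nonzero (H ⟪ pt k j ⟫ 0)

  -- That the head of `H ⟪ 0^ω ⟫` is zero can be proved by refutation, so the double-negated link is
  -- enough for it.
  eventually-stable-heads :
    MarkovsPrinciple → (H : (ℕ → D) → ℕ → D) → (∀ {x y} → x ≗ y → H x ≗ H y) →
    (∀ x → ¬ ¬ Linked x (H x)) → LPO ⊎ ∃ (Stable (heads H))
  eventually-stable-heads mp H H-cong linked =
    eventually-stable mp (λ x → nonzero (H ⟪ x ⟫ 0))
      (λ x≗y → cong nonzero (H-cong (⟪⟫-cong x≗y) 0))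
      (¬-false λ H0 → linked ⟪ 0^ω ⟫ λ link →
        true≢false H0 (trans (cong nonzero (Linked-0^ω link 0)) (nonzero-⌜⌝ false)))

  -- Chains and the counting argument.

  -- φ lowers the index in a chain by one, and chain n n is not in the image of φ.
  chain : ℕ → ℕ → ℕ → D
  chain n k = ⟪ pt (suc k) (n ∸ k) ⟫

  Linked-chain : ∀ {n k} → k ≤ n → Linked (chain n k) y → nonzero (y 0) ≡ false →
                 ∃[ l ] (l ≤ n × parity l ≡ parity (suc k) × y ≗ chain n l)
  Linked-chain {n = n} {k} k≤n link y0 with Linked-pt k (n ∸ k) link y0
  ... | partner {l} {j} t p e = l , subst (l ≤_) total (m≤m+n l j) , p
                              , subst (λ i → _ ≗ ⟪ pt (suc l) i ⟫) j≡n∸l e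
    where
    total : l + j ≡ n
    total = trans t (m+[n∸m]≡n k≤n)
    j≡n∸l : j ≡ n ∸ l
    j≡n∸l = trans (sym (m+n∸m≡n l j)) (cong (_∸ l) total)

  module _ (H G : (ℕ → D) → ℕ → D)
           (H-cong : ∀ {x y} → x ≗ y → H x ≗ H y) (G-cong : ∀ {x y} → x ≗ y → G x ≗ G y)
           (HG : ∀ x → H (G x) ≗ x) (GH : ∀ x → G (H x) ≗ x)
           (H-linked : ∀ x → ¬ ¬ Linked x (H x)) (G-linked : ∀ x → ¬ ¬ Linked x (G x))
           {N : ℕ} (H-stable : Stable (heads H) N) (G-stable : Stable (heads G) N) where

    -- The parity is that of `suc N`, the one index by which `chain (suc N)` exceeds `chain N`.
    Moved : ℕ → Set
    Moved k = parity k ≡ parity (suc N) × heads H (suc k) (suc N ∸ k) ≡ false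

    Moved? : ∀ k → Dec (Moved k)
    Moved? k = (parity k ≟ᵖ parity (suc N)) ×-dec (heads H (suc k) (suc N ∸ k) ≟ᵇ false)

    -- On moved indices, apply H in chain (suc N) and then G in chain N. The first step reverses
    -- the parity, so it avoids the index suc N and its result is also an index in chain N.
    data Θ : ℕ → ℕ → Set where
      fixed : ∀ {k} → ¬ Moved k → Θ k k
      moved : ∀ {k l m} → H (chain (suc N) k) ≗ chain (suc N) l →
              G (chain N l) ≗ chain N m → Moved m → Θ k m

    chain-stable : ∀ {a} → Stable a N → ∀ {l} → l ≤ N → a (suc l) (suc N ∸ l) ≡ a (suc l) (N ∸ l)
    chain-stable {a} (_ , c) {l} l≤N = trans (cong (a (suc l)) (+-∸-assoc 1 l≤N))
      (c (suc l) (N ∸ l) (m≤n⇒m≤1+n (≤-reflexive (sym (m+[n∸m]≡n l≤N)))))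

    last-moved : Moved (suc N)
    last-moved = refl , proj₁ H-stable (suc (suc N)) (N ∸ N) (m≤n⇒m≤1+n (n≤1+n N))

    ≢last : ∀ {k} → k ≤ suc N → k ≢ suc N → k ≤ N
    ≢last k≤ k≢ = s≤s⁻¹ (≤∧≢⇒< k≤ k≢)

    parity-suc : ∀ {k l} → parity l ≡ parity (suc k) → parity (suc l) ≡ parity k
    parity-suc {k} {l} eq = trans (sym (suc-homo-⁻¹ (suc l)))
      (trans (cong _⁻¹ eq) (suc-homo-⁻¹ k))

    Θ-total : ∀ k → k < suc (suc N) → ¬ ¬ (∃[ m ] (m < suc N × Θ k m))
    Θ-total k (s≤s k≤1+N) ¬Θ with Moved? k
    ... | no ¬p = ¬Θ (k , s≤s (≢last k≤1+N λ { refl → ¬p last-moved }) , fixed ¬p)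
    ... | yes (pk , hk) =
      H-linked (chain (suc N) k) λ link →
      let l , l≤1+N , pl , e = Linked-chain k≤1+N link hk
          l≤N : l ≤ N
          l≤N = ≢last l≤1+N λ l≡1+N → p≢p⁻¹ (parity k)
            (trans pk (trans (cong parity (sym l≡1+N)) (trans pl (sym (suc-homo-⁻¹ (suc k))))))
          -- `G` leads from `chain (suc N) l` back to `chain (suc N) k`, whose head is zero;
          -- stability carries this over to `chain N l`.
          gl : heads G (suc l) (N ∸ l) ≡ false
          gl = trans (sym (chain-stable G-stable l≤N))
                 (trans (cong nonzero (trans (G-cong (sym ∘ e) 0) (GH (chain (suc N) k) 0)))
                        (nonzero-⌜⌝ false))
      in
      G-linked (chain N l) λ link′ →
      let m , m≤N , pm , e′ = Linked-chain l≤N link′ gl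
          -- Likewise `H` leads from `chain N m` back to `chain N l`, and stability lifts this to
          -- `chain (suc N) m`.
          hm : heads H (suc m) (suc N ∸ m) ≡ false
          hm = trans (chain-stable H-stable m≤N)
                 (trans (cong nonzero (trans (H-cong (sym ∘ e′) 0) (HG (chain N l) 0)))
                        (nonzero-⌜⌝ false))
      in
      ¬Θ (m , s≤s m≤N , moved {k} {l} e e′ (trans pm (trans (parity-suc {k} {l} pl) pk) , hm))

    chain-injective : ∀ {n k l} → chain n k ≗ chain n l → k ≡ l
    chain-injective {n} {k} {l} eq = suc-injective (pt-injective (n ∸ k) (n ∸ l) eq)

    cancel : ∀ {F F⁻¹ : (ℕ → D) → ℕ → D} → (∀ {x y} → x ≗ y → F⁻¹ x ≗ F⁻¹ y) →
             (∀ x → F⁻¹ (F x) ≗ x) → F x ≗ z → F y ≗ z → x ≗ y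
    cancel F⁻¹-cong F⁻¹F Fx Fy n = trans (sym (F⁻¹F _ n))
      (trans (F⁻¹-cong (λ n → trans (Fx n) (sym (Fy n))) n) (F⁻¹F _ n))

    -- Moved indices land on moved ones, so they never collide with fixed ones; among themselves
    -- they are separated by inverting `G` and then `H`.
    Θ-injective : ∀ {k l m} → Θ k m → Θ l m → k ≡ l
    Θ-injective (fixed _)  (fixed _)      = refl
    Θ-injective (fixed ¬p) (moved _ _ p)  = contradiction p ¬p
    Θ-injective (moved _ _ p) (fixed ¬p)  = contradiction p ¬p
    Θ-injective (moved {l = k′} e₁ f₁ _) (moved {l = l′} e₂ f₂ _)
      with refl ← chain-injective {k = k′} {l′} (cancel {F = G} H-cong HG f₁ f₂)
      = chain-injective (cancel {F = H} G-cong GH e₁ e₂)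

    stable⇒⊥ : ⊥
    stable⇒⊥ = ¬¬-pigeonhole (suc N) Θ Θ-total Θ-injective

  -- From the Myhill property to LPO.

  ¬¬StrongMyhill⇒LPO : MarkovsPrinciple → ¬¬StrongMyhill X → LPO
  ¬¬StrongMyhill⇒LPO mp strongMyhill
    with h , h-linked ← strongMyhill φ-injection φ-injection =
    conclude (eventually-stable-heads mp H H-cong H-linked)
             (eventually-stable-heads mp G G-cong G-linked)
    where
    open Bijection h renaming (to to H; cong to H-cong)
    G : (ℕ → D) → ℕ → D
    G y = proj₁ (strictlySurjective y)
    HG : ∀ y → H (G y) ≗ y
    HG y = proj₂ (strictlySurjective y)
    GH : ∀ x → G (H x) ≗ x
    GH x = injective (HG (H x))
    -- The chosen preimages respect pointwise equality because `H` is injective.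
    G-cong : x ≗ y → G x ≗ G y
    G-cong {x} {y} x≗y = injective λ n → trans (HG x n) (trans (x≗y n) (sym (HG y n)))
    H-linked : ∀ x → ¬ ¬ Linked x (H x)
    H-linked x ¬link = h-linked x λ (m , r) → ¬link (R⇒Linked m r)
    G-linked : ∀ y → ¬ ¬ Linked y (G y)
    G-linked y ¬link = H-linked (G y) λ link → ¬link (Linked-sym (Linked-congʳ (HG y) link))

    conclude : LPO ⊎ ∃ (Stable (heads H)) → LPO ⊎ ∃ (Stable (heads G)) → LPO
    conclude (inj₁ lpo)     _              = lpo
    conclude (inj₂ _)       (inj₁ lpo)     = lpo
    conclude (inj₂ (M , s)) (inj₂ (N , t)) = ⊥-elim (stable⇒⊥ H G H-cong G-cong HG GH
      H-linked G-linked (Stable-mono (m≤m⊔n M N) s) (Stable-mono (m≤n⊔m M N) t))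

theorem50 : MarkovsPrinciple → ¬¬StrongMyhill Baire ⊎ ¬¬StrongMyhill Cantor → LPO
theorem50 mp = [ Sequences.¬¬StrongMyhill⇒LPO ℕ (λ b → if b then 1 else 0) (0 <ᵇ_)
                   (λ { true → refl ; false → refl }) (λ { zero _ → refl }) mp
               , Sequences.¬¬StrongMyhill⇒LPO Bool id id (λ _ → refl) (λ _ → id) mp
               ]′
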